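{- Let $\mathcal{L}\subseteq\mathrm{Scat}$ be nonempty, downward $\preceq$-closed and ccs. Then there exists a family $\mathcal{F}\subseteq\mathrm{LO}$ of size $\aleph_1$ which is unbounded with respect to $\trianglelefteq^{\mathcal{L}}_{\mathrm{LO}}$. Thus $\mathfrak{b}(\trianglelefteq^{\mathcal{L}}_{\mathrm{LO}})=\aleph_1$.
   Context: Linear orders are reflexive and nonempty. $L\preceq L'$ means there is an embedding $f:L\to L'$, i.e. $x\le_L y\iff f(x)\le_{L'}f(y)$. $\mathrm{LO}\subseteq 2^{\mathbb{N}\times\mathbb{N}}$ is the set of (codes for) linear orders with domain $\mathbb{N}$; $\mathrm{Fin}$ is the set of (codes for) nonempty linear orders on finite subsets of $\mathbb{N}$; $\mathrm{Lin}=\mathrm{Fin}\cup\mathrm{LO}$; $\mathrm{Scat}\subseteq\mathrm{Lin}$ is the set of scattered ones (those $L$ with $\mathbb{Q}\not\preceq L$). A class $\mathcal{L}\subseteq\mathrm{Lin}$ is downward $\preceq$-closed if $K\in\mathrm{Lin}$ and $K\preceq L\in\mathcal{L}$ imply $K\in\mathcal{L}$; membership in $\mathcal{L}$ is meant up to isomorphism. A subset $I$ of a linear order $L$ is convex if $x\le_L y\le_L z$ and $x,z\in I$ imply $y\in I$. For $A,B\subseteq L$ write $A\le_L B$ (resp. $A<_L B$) if $a\le_L b$ (resp. $a<_L b$) for all $a\in A$, $b\in B$. A $K$-convex partition of $L$ is a partition $(L_k)_{k\in K}$ of $L$ (into nonempty sets) such that $k<_K k'\iff L_k<_L L_{k'}$.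 The relation $L\trianglelefteq^{\mathcal{L}}L'$ holds iff there are $K\in\mathcal{L}$, a $K$-convex partition $(L_k)_{k\in K}$ of $L$, and an embedding $f$ of $L$ into $L'$ such that $f(L_k)$ is a convex subset of $L'$ for every $k\in K$. $\trianglelefteq^{\mathcal{L}}_{\mathrm{LO}}$ is its restriction to $\mathrm{LO}$. $\mathcal{L}$ is ccs (closed under convex sums) if for all $K,K'\in\mathcal{L}$ and every family $(K'_k)_{k\in K}$ of nonempty convex subsets of $K'$ such that $k_0<_K k_1\Rightarrow K'_{k_0}\le_{K'}K'_{k_1}$, we have $\sum_{k\in K}K'_k\in\mathcal{L}$, where $\sum_{k\in K}K'_k=\{(x,k): k\in K, x\in K'_k\}$ ordered antilexicographically. When $\mathcal{L}$ is ccs, $\trianglelefteq^{\mathcal{L}}$ is a quasi-order. For a quasi-order $\precsim$ on $X$, a set $\mathcal{F}\subseteq X$ is unbounded if there is no $x\in X$ with $y\precsim x$ for all $y\in\mathcal{F}$; the unbounding number $\mathfrak{b}(\precsim)$ is the least size of an unbounded subset of $X$. -}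

module Defs where

open import Level using (Level; _⊔_; 0ℓ) renaming (suc to lsuc)
open import Data.Bool using (Bool; T)
open import Data.Nat using (ℕ) renaming (_<_ to _<ℕ_)
open import Data.Product using (Σ; ∃; _×_; _,_; proj₁; proj₂)
open import Data.Product.Relation.Binary.Lex.NonStrict using (×-Lex)
import Data.Rational as ℚ
open import Data.Sum using (inj₂)
open import Function using (_on_; _∘_)
open import Function.Bundles using (_⇔_; Func; Surjection; Injection; Bijection)
open import Induction.WellFounded using (WellFounded)
open import Relation.Binary.Bundles using (Setoid)
open import Relation.Binary.Core using (Rel)
open import Relation.Binary.Definitions using (_Respects_)
open import Relation.Binary.Structures using (IsTotalOrder)
import Relation.Binary.Construct.NonStrictToStrict as ToStrict
import Relation.Binary.Construct.On as On
import Relation.Binary.Morphism.Construct.Composition as Comp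
import Relation.Binary.Morphism.Construct.Identity as Id
open import Relation.Binary.Morphism.Structures using (IsOrderMonomorphism; IsOrderIsomorphism)
open import Relation.Binary.PropositionalEquality
  using (_≡_; refl; sym; trans; cong; subst₂; _→-setoid_)
open import Relation.Nullary using (¬_)
open import Relation.Unary using (Pred; _∈_; _∪_; Satisfiable)

private
  variable
    a b x ℓ ℓ₁ ℓ₂ : Level

------------------------------------------------------------------------
-- The set-theoretic background

-- Choice in the form "every surjection splits". The section is required to
-- respect the setoid equalities, so this is genuine (extensional) choice, and
-- it implies excluded middle by Diaconescu's argument. It is what a ZFC theorem
-- about ℵ₁ has to assume here; in particular it makes the universe level of
-- subsets and the use of Bool-valued codes immaterial.
AxiomOfChoice : ∀ a b ℓ₁ ℓ₂ → Set (lsuc (a ⊔ b ⊔ ℓ₁ ⊔ ℓ₂))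
AxiomOfChoice a b ℓ₁ ℓ₂ =
  {S : Setoid a ℓ₁} {T : Setoid b ℓ₂} (f : Surjection S T) →
  Σ (Func T S) λ g → ∀ y → Setoid._≈_ T (Surjection.to f (Func.to g y)) y

------------------------------------------------------------------------
-- Codes of linear orders

Code : Set
Code = ℕ × ℕ → Bool

-- Orders are reflexive, so a code determines its domain {n : n ≤ n}.
-- T is proof-irrelevant: equality of elements is equality of naturals.
Dom : Code → Set
Dom c = ∃ λ n → T (c (n , n))

Le : (c : Code) → Rel (Dom c) 0ℓ
Le c p q = T (c (proj₁ p , proj₁ q))

Lt : (c : Code) → Rel (Dom c) 0ℓ
Lt c = ToStrict._<_ _≡_ (Le c)

-- The domain may be any subset of ℕ, including the empty one.
record IsLinear (c : Code) : Set where
  field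
    field-⊆-Dom  : ∀ {m n} → T (c (m , n)) → T (c (m , m)) × T (c (n , n))
    isTotalOrder : IsTotalOrder _≡_ (Le c)

IsFin : Pred Code 0ℓ
IsFin c = IsLinear c × Dom c × ∃ λ b → ∀ (p : Dom c) → proj₁ p <ℕ b

IsLO : Pred Code 0ℓ
IsLO c = IsLinear c × (∀ n → T (c (n , n)))

Lin : Set
Lin = ∃ (IsFin ∪ IsLO)

LO : Set
LO = ∃ IsLO

LO⇒Lin : LO → Lin
LO⇒Lin (c , lo) = c , inj₂ lo

-- LO as a subset of 2^(ℕ×ℕ): codes are compared pointwise.
LO-setoid : Setoid 0ℓ 0ℓ
LO-setoid = On.setoid {B = LO} ((ℕ × ℕ) →-setoid Bool) proj₁

------------------------------------------------------------------------
-- Embeddings and isomorphisms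

Embeds : {A : Set a} {B : Set b} → Rel A ℓ₁ → Rel B ℓ₂ → Set (a ⊔ b ⊔ ℓ₁ ⊔ ℓ₂)
Embeds R S = ∃ (IsOrderMonomorphism _≡_ _≡_ R S)

_≼_ : Rel Lin 0ℓ
K ≼ L = Embeds (Le (proj₁ K)) (Le (proj₁ L))

Scat : Pred Lin 0ℓ
Scat L = ¬ Embeds ℚ._≤_ (Le (proj₁ L))

_≅_ : Rel Code 0ℓ
c ≅ d = ∃ (IsOrderIsomorphism _≡_ _≡_ (Le c) (Le d))

≅-refl : ∀ {c} → c ≅ c
≅-refl = _ , Id.isOrderIsomorphism _ _ refl

≅-trans : ∀ {c d e} → c ≅ d → d ≅ e → c ≅ e
≅-trans (f , f-iso) (g , g-iso) = g ∘ f , Comp.isOrderIsomorphism trans f-iso g-iso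

≅-sym : ∀ {c d} → c ≅ d → d ≅ c
≅-sym {c} {d} (f , f-iso) = g , record
  { isOrderMonomorphism = record
    { isOrderHomomorphism = record
      { cong = cong g
      ; mono = λ {p} {q} p≤q → F.cancel (subst₂ (Le d) (sym (fg p)) (sym (fg q)) p≤q)
      }
    ; injective = λ {p} {q} e → trans (sym (fg p)) (trans (cong f e) (fg q))
    ; cancel    = λ {p} {q} gp≤gq → subst₂ (Le d) (fg p) (fg q) (F.mono gp≤gq)
    }
  ; surjective = λ p → f p , λ { refl → F.injective (fg (f p)) }
  }
  where
  module F = IsOrderIsomorphism f-iso

  g : Dom d → Dom c
  g q = proj₁ (F.surjective q)

  fg : ∀ q → f (g q) ≡ q
  fg q = proj₂ (F.surjective q) refl

------------------------------------------------------------------------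
-- Convexity and the relation ⊴

Convex : (c : Code) → Pred (Pred (Dom c) ℓ) ℓ
Convex c I = ∀ {p q r} → Le c p q → Le c q r → p ∈ I → r ∈ I → q ∈ I

SetLe : (c : Code) → Rel (Pred (Dom c) 0ℓ) 0ℓ
SetLe c A B = ∀ {p q} → p ∈ A → q ∈ B → Le c p q

SetLt : (c : Code) → Rel (Pred (Dom c) 0ℓ) 0ℓ
SetLt c A B = ∀ {p q} → p ∈ A → q ∈ B → Lt c p q

Image : {A : Set a} {B : Set b} → (A → B) → Pred A ℓ → Pred B (a ⊔ b ⊔ ℓ)
Image f P y = ∃ λ p → p ∈ P × f p ≡ y

record IsConvexPartition (K L : Code) (block : Dom K → Pred (Dom L) 0ℓ) : Set where
  field
    nonempty : ∀ k → Satisfiable (block k)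
    cover    : ∀ p → ∃ λ k → p ∈ block k
    disjoint : ∀ {k k′ p} → p ∈ block k → p ∈ block k′ → k ≡ k′
    ordered  : ∀ {k k′} → Lt K k k′ ⇔ SetLt L (block k) (block k′)

_⊴[_]_ : Lin → Pred Lin ℓ → Lin → Set (lsuc 0ℓ ⊔ ℓ)
(L , _) ⊴[ 𝓛 ] (L′ , _) =
  Σ Lin λ K → K ∈ 𝓛 ×
  Σ (Dom (proj₁ K) → Pred (Dom L) 0ℓ) λ block →
  IsConvexPartition (proj₁ K) L block ×
  Σ (Dom L → Dom L′) λ f →
  IsOrderMonomorphism _≡_ _≡_ (Le L) (Le L′) f ×
  (∀ k → Convex L′ (Image f (block k)))

⊴LO : Pred Lin ℓ → Rel LO (lsuc 0ℓ ⊔ ℓ)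
⊴LO 𝓛 L L′ = LO⇒Lin L ⊴[ 𝓛 ] LO⇒Lin L′

------------------------------------------------------------------------
-- Closure properties of classes

DownwardClosed : Pred Lin ℓ → Set ℓ
DownwardClosed 𝓛 = ∀ {K L} → K ≼ L → L ∈ 𝓛 → K ∈ 𝓛

-- Elements of ∑_{k∈K} K′_k, stored with the index first, so that the
-- antilexicographic order on the pairs (p , k) is the lexicographic one here.
-- SumEq disregards the proof of p ∈ K′_k.
module _ (K K′ : Code) (K′ₖ : Dom K → Pred (Dom K′) 0ℓ) where

  Sum : Set
  Sum = Σ (Dom K × Dom K′) λ (k , p) → p ∈ K′ₖ k

  SumEq : Rel Sum 0ℓ
  SumEq = _≡_ on proj₁

  SumLe : Rel Sum 0ℓ
  SumLe = ×-Lex _≡_ (Le K) (Le K′) on proj₁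

-- The sum is not literally a code, so membership in 𝓛 is up to isomorphism.
CCS : Pred Lin ℓ → Set (lsuc 0ℓ ⊔ ℓ)
CCS 𝓛 =
  ∀ {K K′} → K ∈ 𝓛 → K′ ∈ 𝓛 →
  let k = proj₁ K ; k′ = proj₁ K′ in
  (K′ₖ : Dom k → Pred (Dom k′) 0ℓ) →
  (∀ i → Satisfiable (K′ₖ i)) →
  (∀ i → Convex k′ (K′ₖ i)) →
  (∀ {i j} → Lt k i j → SetLe k′ (K′ₖ i) (K′ₖ j)) →
  Σ Lin λ J → J ∈ 𝓛 ×
  ∃ (IsOrderIsomorphism _≡_ (SumEq k k′ K′ₖ) (Le (proj₁ J)) (SumLe k k′ K′ₖ))

------------------------------------------------------------------------
-- Cardinals and the unbounding number

-- ω₁, the set of countable ordinals: well-orders on arbitrary subsets of ℕ, up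
-- to isomorphism. Its cardinality is ℵ₁. Cardinals are represented by setoids.
ω₁ : Setoid 0ℓ 0ℓ
ω₁ = record
  { Carrier       = ∃ λ c → IsLinear c × WellFounded (Lt c)
  ; _≈_           = _≅_ on proj₁
  ; isEquivalence = record { refl = ≅-refl ; sym = ≅-sym ; trans = ≅-trans }
  }

module _ (X : Setoid x ℓ₁) where
  open Setoid X

  record Subset : Set (lsuc x ⊔ ℓ₁) where
    field
      member   : Pred Carrier x
      respects : member Respects _≈_

    asSetoid : Setoid x ℓ₁
    asSetoid = On.setoid {B = ∃ member} X proj₁

  open Subset

  HasSize : Subset → Setoid a ℓ → Set _
  HasSize F κ = Bijection κ (asSetoid F)

  Unbounded : Rel Carrier ℓ₂ → Subset → Set _
  Unbounded _≲_ F = ¬ ∃ λ u → ∀ y → y ∈ member F → y ≲ u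

  IsUnboundingNumber : Rel Carrier ℓ₂ → Setoid a ℓ → Set _
  IsUnboundingNumber _≲_ κ =
    (Σ Subset λ F → HasSize F κ × Unbounded _≲_ F) ×
    (∀ F → Unbounded _≲_ F → Injection κ (asSetoid F))

{-# OPTIONS --safe #-}
module Submission where

-- Excluded middle follows from choice by Diaconescu's argument and is used
-- throughout.
--
-- An unbounded family of size ℵ₁. For a countable ordinal α let Hat α be a
-- well-order of ℕ of which α is a proper initial segment, and let the spread of
-- α be a sum of copies of Hat α over an order of ℕ in which the rationals
-- embed. If the spread is piecewise convexly embedded in L′, with pieces
-- indexed by a scattered K, then some piece meets the copies at two distinct
-- rationals: otherwise the rationals would embed in K. That piece contains a
-- whole copy at a rational in between, so Hat α embeds in L′ with convex range
-- (copy-convexlyEmbeds). Not every α can be like this for one countable L′: for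
-- x in L′ let the segment of x consist of the y above x such that the interval
-- from x to y is well-ordered. The sum over x of the segments, each extended by
-- an element on top, is a countable ordinal α. A copy of Hat α with convex
-- range lies in the segment of its least element x. As α contains this segment
-- with an element on top, the segment extended by that element would embed in
-- the segment itself, which no well-order allows (Long-¬convexlyEmbeds). The
-- codes are arranged so that distinct ordinals, taken through representatives
-- of the isomorphism classes, have distinct spreads.
--
-- No smaller unbounded set. A countable family is bounded by its sum over the
-- natural numbers, in which every member is convex: the partition into one
-- piece works, because a one-point order belongs to every nonempty downward
-- closed class (countable-bounded). Hence an unbounded F is not exhausted by
-- countably many of its members, and transfinite recursion sends every
-- countable ordinal to a member of F avoiding the values at smaller ordinals.
-- The recursion runs inside each well-order separately. Its values depend only
-- on the rank of an element, since the member taken depends only on the set of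
-- earlier values and not on how they are listed. Comparability of well-orders
-- then shows that non-isomorphic ordinals receive distinct values
-- (value-injective).

open import Defs
open import Level using (Level; _⊔_; 0ℓ; Setω) renaming (suc to lsuc)
open import Data.Bool using (Bool; true; false; T)
open import Data.Bool.Properties using (T-irrelevant; T?) renaming (_≟_ to _≟ᵇ_)
open import Data.Empty using (⊥)
open import Data.Integer using (ℤ; +_; -[1+_])
open import Data.Nat using (ℕ; zero; suc; _+_; _≤_; _<_; z≤n; s≤s)
import Data.Nat.Properties as ℕ
open import Data.Nat.Induction using (<-wellFounded)
open import Data.Product using (Σ; ∃; _×_; _,_; proj₁; proj₂)
open import Data.Rational using (ℚ; fromℚᵘ)
import Data.Rational as ℚ
import Data.Rational.Properties as ℚ
open import Data.Rational.Unnormalised using (mkℚᵘ)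
open import Data.Sum using (_⊎_; inj₁; inj₂; [_,_]′)
open import Data.Unit using (⊤; tt)
open import Function using (_∘_; id)
open import Function.Bundles using (mk⇔; Equivalence; Func; Surjection; Injection)
open import Induction.WellFounded using (WellFounded; Acc; acc; module Subrelation)
open import Relation.Binary.Bundles using (Setoid)
open import Relation.Binary.Core using (Rel)
open import Relation.Binary.Definitions using (Transitive; Antisymmetric; Total)
open import Relation.Binary.Structures using (IsTotalOrder)
import Relation.Binary.Construct.NonStrictToStrict as ToStrict
import Relation.Binary.Construct.On as On
open import Relation.Binary.Morphism.Structures using (IsOrderMonomorphism; IsOrderIsomorphism)
open import Relation.Binary.PropositionalEquality
  using (_≡_; refl; sym; trans; cong; subst; subst₂; isEquivalence; setoid)
open import Relation.Nullary using (¬_; Dec; yes; no; contradiction)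
open import Relation.Nullary.Decidable using (⌊_⌋; toWitness; fromWitness; toSum; decidable-stable)
open import Relation.Unary using (Pred; _∈_; _⊆_; Satisfiable)

private
  variable
    a b ℓ ℓ₁ ℓ₂ : Level
    A B : Set a

------------------------------------------------------------------------
-- Choice and excluded middle

Choice : Setω
Choice = ∀ {a b ℓ₁ ℓ₂} → AxiomOfChoice a b ℓ₁ ℓ₂

ExcludedMiddle : Setω
ExcludedMiddle = ∀ {ℓ} (P : Set ℓ) → Dec P

-- Diaconescu's argument: identify the two booleans exactly when P holds, and
-- compare the representatives that a section picks for them.
excludedMiddle : Choice → ExcludedMiddle
excludedMiddle ac {ℓ} P with ac surj
  where
  Two : Setoid 0ℓ ℓ
  Two = record
    { Carrier = Bool
    ; _≈_ = λ x y → x ≡ y ⊎ P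
    ; isEquivalence = record
      { refl = inj₁ refl
      ; sym = λ { (inj₁ e) → inj₁ (sym e) ; (inj₂ p) → inj₂ p }
      ; trans = λ { (inj₁ refl) q → q ; (inj₂ p) _ → inj₂ p }
      }
    }

  surj : Surjection (setoid Bool) Two
  surj = record
    { to = id ; cong = inj₁ ; surjective = λ y → y , λ { refl → inj₁ refl } }
... | g , section with Func.to g true ≟ᵇ Func.to g false
...   | no  ne = no λ p → ne (Func.cong g (inj₂ p))
...   | yes e with section true | section false
...     | inj₂ p | _ = yes p
...     | _ | inj₂ p = yes p
...     | inj₁ t | inj₁ f with trans (sym t) (trans e f)
...       | ()

-- A nonempty predicate on a well-founded order has a minimal element.
minimal : ExcludedMiddle → {_<_ : Rel A ℓ₁} → WellFounded _<_ →
          (P : Pred A ℓ₂) → ∃ P → ∃ λ m → P m × (∀ {n} → n < m → ¬ P n)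
minimal lem {_<_ = _<_} wf P (x , px) = go x (wf x) px
  where
  go : ∀ x → Acc _<_ x → P x → ∃ λ m → P m × (∀ {n} → n < m → ¬ P n)
  go x (acc rs) px with lem (∃ λ y → y < x × P y)
  ... | yes (y , y<x , py) = go y (rs y<x) py
  ... | no  none = x , px , λ n<x pn → none (_ , n<x , pn)

------------------------------------------------------------------------
-- Total orders and their strict parts

-- The strict part of an order.
Strict : {A : Set a} → Rel A ℓ → Rel A (a ⊔ ℓ)
Strict _≤_ = ToStrict._<_ _≡_ _≤_

connex : ExcludedMiddle → {_≤_ : Rel A ℓ} → IsTotalOrder _≡_ _≤_ →
         ∀ x y → Strict _≤_ x y ⊎ x ≡ y ⊎ Strict _≤_ y x
connex lem ≤-to x y with lem (x ≡ y)
... | yes e = inj₂ (inj₁ e)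
... | no ne with IsTotalOrder.total ≤-to x y
...   | inj₁ x≤y = inj₁ (x≤y , ne)
...   | inj₂ y≤x = inj₂ (inj₂ (y≤x , ne ∘ sym))

isTotalOrder≡ : {_≤_ : Rel A ℓ} → (∀ x → x ≤ x) → Transitive _≤_ →
                Antisymmetric _≡_ _≤_ → Total _≤_ → IsTotalOrder _≡_ _≤_
isTotalOrder≡ r t an to = record
  { isPartialOrder = record
    { isPreorder = record
      { isEquivalence = isEquivalence
      ; reflexive = λ { refl → r _ }
      ; trans = t
      }
    ; antisym = an
    }
  ; total = to
  }

-- Between total orders, strictly monotone maps are embeddings.
strictlyMonotone⇒embedding : ExcludedMiddle →
  {_≤₁_ : Rel A ℓ₁} {_≤₂_ : Rel B ℓ₂} →
  IsTotalOrder _≡_ _≤₁_ → IsTotalOrder _≡_ _≤₂_ → {f : A → B} →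
  (∀ {x y} → Strict _≤₁_ x y → Strict _≤₂_ (f x) (f y)) →
  IsOrderMonomorphism _≡_ _≡_ _≤₁_ _≤₂_ f
strictlyMonotone⇒embedding lem {_≤₁_} {_≤₂_} to₁ to₂ {f} f-mono = record
  { isOrderHomomorphism = record { cong = cong f ; mono = mono }
  ; injective = injective
  ; cancel = cancel
  }
  where
  module O₁ = IsTotalOrder to₁
  module O₂ = IsTotalOrder to₂

  mono : ∀ {x y} → x ≤₁ y → f x ≤₂ f y
  mono {x} {y} x≤y with lem (x ≡ y)
  ... | yes refl = O₂.refl
  ... | no ne = proj₁ (f-mono (x≤y , ne))

  injective : ∀ {x y} → f x ≡ f y → x ≡ y
  injective {x} {y} e with connex lem to₁ x y
  ... | inj₁ x<y = contradiction e (proj₂ (f-mono x<y))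
  ... | inj₂ (inj₁ x≡y) = x≡y
  ... | inj₂ (inj₂ y<x) = contradiction (sym e) (proj₂ (f-mono y<x))

  cancel : ∀ {x y} → f x ≤₂ f y → x ≤₁ y
  cancel {x} {y} fx≤fy with connex lem to₁ x y
  ... | inj₁ x<y = proj₁ x<y
  ... | inj₂ (inj₁ refl) = O₁.refl
  ... | inj₂ (inj₂ y<x) =
    contradiction fx≤fy (ToStrict.<⇒≱ _≡_ _≤₂_ O₂.antisym (f-mono y<x))

-- A strictly monotone self-map of a well-founded order has no value below its
-- argument: x > f x > f (f x) > ... would descend forever.
strictlyMonotone⇒¬< : {_<_ : Rel A ℓ} → WellFounded _<_ → (f : A → A) →
  (∀ {x y} → x < y → f x < f y) → ∀ x → ¬ f x < x
strictlyMonotone⇒¬< {_<_ = _<_} wf f f-mono x = go x (wf x)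
  where
  go : ∀ x → Acc _<_ x → ¬ f x < x
  go x (acc rs) fx<x = go (f x) (rs fx<x) (f-mono fx<x)

-- The order of a sum of orders on ℕ. Elements are stored with the index first, so
-- the order is lexicographic.
data Lex {I : Set a} (_≤ᴵ_ : Rel I ℓ₁) (R : I → Rel ℕ ℓ₂) : Rel (I × ℕ) (a ⊔ ℓ₁ ⊔ ℓ₂) where
  across : ∀ {i j m n} → Strict _≤ᴵ_ i j → Lex _≤ᴵ_ R (i , m) (j , n)
  within : ∀ {i m n} → R i m n → Lex _≤ᴵ_ R (i , m) (i , n)

module LexProperties {I : Set a} {_≤ᴵ_ : Rel I ℓ₁} {R : I → Rel ℕ ℓ₂}
  (≤ᴵ-to : IsTotalOrder _≡_ _≤ᴵ_) where

  private
    module O = IsTotalOrder ≤ᴵ-to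

  isTotalOrder : ExcludedMiddle → (∀ i → IsTotalOrder _≡_ (R i)) →
                 IsTotalOrder _≡_ (Lex _≤ᴵ_ R)
  isTotalOrder lem R-to = isTotalOrder≡
    (λ (i , m) → within (R.refl i)) lex-trans antisym total
    where
    module R i = IsTotalOrder (R-to i)

    lex-trans : Transitive (Lex _≤ᴵ_ R)
    lex-trans (across p) (across q) =
      across (ToStrict.<-trans _≡_ _≤ᴵ_ O.isPartialOrder p q)
    lex-trans (across p) (within _) = across p
    lex-trans (within _) (across q) = across q
    lex-trans (within p) (within q) = within (R.trans _ p q)

    antisym : Antisymmetric _≡_ (Lex _≤ᴵ_ R)
    antisym (across p) (across q) =
      contradiction q (ToStrict.<-asym _≡_ _≤ᴵ_ O.antisym p)
    antisym (across p) (within _) = contradiction refl (proj₂ p)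
    antisym (within _) (across q) = contradiction refl (proj₂ q)
    antisym (within p) (within q) = cong (_ ,_) (R.antisym _ p q)

    total : Total (Lex _≤ᴵ_ R)
    total (i , m) (j , n) with connex lem ≤ᴵ-to i j
    ... | inj₁ i<j = inj₁ (across i<j)
    ... | inj₂ (inj₂ j<i) = inj₂ (across j<i)
    ... | inj₂ (inj₁ refl) with R.total i m n
    ...   | inj₁ p = inj₁ (within p)
    ...   | inj₂ p = inj₂ (within p)

  -- Each summand is convex.
  between : ∀ {i m j n k} → Lex _≤ᴵ_ R (i , m) (j , n) →
            Lex _≤ᴵ_ R (j , n) (i , k) → i ≡ j
  between (within _) _ = refl
  between (across _) (within _) = refl
  between (across p) (across q) = contradiction q (ToStrict.<-asym _≡_ _≤ᴵ_ O.antisym p)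

  wellFounded : WellFounded (Strict _≤ᴵ_) → (∀ i → WellFounded (Strict (R i))) →
                WellFounded (Strict (Lex _≤ᴵ_ R))
  wellFounded I-wf R-wf (i , m) = go i (I-wf i) m (R-wf i m)
    where
    go : ∀ i → Acc (Strict _≤ᴵ_) i → ∀ m → Acc (Strict (R i)) m →
         Acc (Strict (Lex _≤ᴵ_ R)) (i , m)
    go i (acc rs) = inner
      where
      inner : ∀ m → Acc (Strict (R i)) m → Acc (Strict (Lex _≤ᴵ_ R)) (i , m)
      inner m (acc rt) = acc λ
        { {j , n} (across j<i , _) → go j (rs j<i) n (R-wf j n)
        ; {j , n} (within n≤m , ne) → inner n (rt (n≤m , ne ∘ cong (i ,_)))
        }

-- The order _≤_ pulled back along f.
record Via {A : Set a} {B : Set b} (f : A → B) (_≤_ : Rel B ℓ) (x y : A) : Set ℓ where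
  constructor via
  field
    at : f x ≤ f y

module ViaProperties {f : A → B} (f-inj : ∀ {x y} → f x ≡ f y → x ≡ y)
  {_≤_ : Rel B ℓ} where

  isTotalOrder : IsTotalOrder _≡_ _≤_ → IsTotalOrder _≡_ (Via f _≤_)
  isTotalOrder to = isTotalOrder≡ (λ _ → via O.refl) (λ (via p) (via q) → via (O.trans p q))
    (λ (via p) (via q) → f-inj (O.antisym p q))
    (λ x y → [ inj₁ ∘ via , inj₂ ∘ via ]′ (O.total (f x) (f y)))
    where module O = IsTotalOrder to

  wellFounded : WellFounded (Strict _≤_) → WellFounded (Strict (Via f _≤_))
  wellFounded wf = Subrelation.wellFounded
    (λ (via p , ne) → p , ne ∘ f-inj) (On.wellFounded f wf)

------------------------------------------------------------------------
-- A bijection between ℕ and ℕ × ℕ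

-- The definitions are opaque because only the laws of a bijection matter; unfolded
-- codes of pairs would obstruct the inference of their components.
opaque

  triangle : ℕ → ℕ
  triangle zero    = zero
  triangle (suc n) = suc n + triangle n

  -- Cantor's pairing: pairs with the same sum are numbered consecutively.
  pair : ℕ → ℕ → ℕ
  pair m n = n + triangle (m + n)

  -- The pair whose number is one greater.
  next : ℕ × ℕ → ℕ × ℕ
  next (zero  , n) = suc n , zero
  next (suc m , n) = m , suc n

  unpair : ℕ → ℕ × ℕ
  unpair zero    = zero , zero
  unpair (suc k) = next (unpair k)

  unpair-pair : ∀ m n → unpair (pair m n) ≡ (m , n)
  unpair-pair m n = go (m + n) n m refl
    where
    go : ∀ s n m → m + n ≡ s → unpair (n + triangle s) ≡ (m , n)
    go zero zero zero refl = refl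
    go (suc s) zero m e with trans (sym (ℕ.+-identityʳ m)) e
    ... | refl = cong next (go s s zero refl)
    go s (suc n) m e = cong next (go s n (suc m) (trans (sym (ℕ.+-suc m n)) e))

  pair-unpair : ∀ k → pair (proj₁ (unpair k)) (proj₂ (unpair k)) ≡ k
  pair-unpair zero = refl
  pair-unpair (suc k) = trans (pair-next (unpair k)) (cong suc (pair-unpair k))
    where
    pair-next : ∀ p → pair (proj₁ (next p)) (proj₂ (next p)) ≡ suc (pair (proj₁ p) (proj₂ p))
    pair-next (zero , n) = cong (λ s → suc (s + triangle s)) (ℕ.+-identityʳ n)
    pair-next (suc m , n) = cong (λ s → suc (n + triangle s)) (ℕ.+-suc m n)

  unpair-injective : ∀ {k l} → unpair k ≡ unpair l → k ≡ l
  unpair-injective {k} {l} e =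
    trans (sym (pair-unpair k)) (trans (cong (λ (m , n) → pair m n) e) (pair-unpair l))

------------------------------------------------------------------------
-- Orders on ℕ: codes, sums, and completion to all of ℕ

-- The order on ℕ with the given code.
⟦_⟧ : Code → Rel ℕ 0ℓ
⟦ c ⟧ m n = T (c (m , n))

Dom-≡ : ∀ {c} {p q : Dom c} → proj₁ p ≡ proj₁ q → p ≡ q
Dom-≡ {p = m , s} {q = m , t} refl = cong (m ,_) (T-irrelevant s t)

-- The element n of an order whose domain is ℕ.
element : (L : LO) → ℕ → Dom (proj₁ L)
element (_ , _ , full) n = n , full n

LO-isTotalOrder : (L : LO) → IsTotalOrder _≡_ ⟦ proj₁ L ⟧
LO-isTotalOrder L@(_ , lin , full) =
  isTotalOrder≡ full
    (λ {i} {j} {k} → O.trans {element L i} {element L j} {element L k})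
    (λ {i} {j} p q → cong proj₁ (O.antisym {element L i} {element L j} p q))
    (λ i j → O.total (element L i) (element L j))
  where module O = IsTotalOrder (IsLinear.isTotalOrder lin)

-- A linear order on its field, a subset of ℕ.
record IsLinearOnField (R : Rel ℕ 0ℓ) : Set where
  field
    left       : ∀ {m n} → R m n → R m m
    right      : ∀ {m n} → R m n → R n n
    transitive : Transitive R
    antisym    : Antisymmetric _≡_ R
    total      : ∀ {m n} → R m m → R n n → R m n ⊎ R n m

code-isLinearOnField : ∀ {c} → IsLinear c → IsLinearOnField ⟦ c ⟧
code-isLinearOnField lin = record
  { left  = λ p → proj₁ (field-⊆-Dom p)
  ; right = λ p → proj₂ (field-⊆-Dom p)
  ; transitive = λ p q → O.trans {_ , proj₁ (field-⊆-Dom p)}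
      {_ , proj₁ (field-⊆-Dom q)} {_ , proj₂ (field-⊆-Dom q)} p q
  ; antisym = λ p q → cong proj₁
      (O.antisym {_ , proj₁ (field-⊆-Dom p)} {_ , proj₁ (field-⊆-Dom q)} p q)
  ; total = λ p q → O.total (_ , p) (_ , q)
  }
  where
  open IsLinear lin
  module O = IsTotalOrder isTotalOrder

code-wellFounded : ∀ {c} → IsLinear c → WellFounded (Lt c) → WellFounded (Strict ⟦ c ⟧)
code-wellFounded {c} lin wf n = acc λ (p , ne) →
  below (wf (_ , proj₁ (IsLinear.field-⊆-Dom lin p)))
  where
  below : ∀ {p} → Acc (Lt c) p → Acc (Strict ⟦ c ⟧) (proj₁ p)
  below (acc rs) = acc λ (p , ne) →
    below (rs {_ , proj₁ (IsLinear.field-⊆-Dom lin p)} (p , ne ∘ cong proj₁))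

module _ (lem : ExcludedMiddle) where

  opaque

    -- The characteristic function of R.
    codeOf : Rel ℕ 0ℓ → Code
    codeOf R (m , n) = ⌊ lem (R m n) ⌋

    ∈codeOf : ∀ {R m n} → T (codeOf R (m , n)) → R m n
    ∈codeOf = toWitness

    codeOf∋ : ∀ {R m n} → R m n → T (codeOf R (m , n))
    codeOf∋ = fromWitness

  -- The member of LO given by a total order on ℕ.
  toLO : (R : Rel ℕ 0ℓ) → IsTotalOrder _≡_ R → LO
  toLO R to = codeOf R , record
    { field-⊆-Dom = λ _ → codeOf∋ {R} O.refl , codeOf∋ {R} O.refl
    ; isTotalOrder = isTotalOrder≡
        (λ (_ , p) → p)
        (λ p q → codeOf∋ {R} (O.trans (∈codeOf {R} p) (∈codeOf {R} q)))
        (λ p q → Dom-≡ {codeOf R} (O.antisym (∈codeOf {R} p) (∈codeOf {R} q)))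
        (λ (m , _) (n , _) → [ inj₁ ∘ codeOf∋ {R} , inj₂ ∘ codeOf∋ {R} ]′ (O.total m n))
    } , λ n → codeOf∋ {R} O.refl
    where module O = IsTotalOrder to

  codeOf-wellFounded : ∀ {R} → WellFounded (Strict R) → WellFounded (Lt (codeOf R))
  codeOf-wellFounded {R} wf = Subrelation.wellFounded
    (λ (p , ne) → ∈codeOf {R} p , λ e → ne (Dom-≡ {codeOf R} e))
    (On.wellFounded proj₁ wf)

-- The sum over the order _≤_ on ℕ of the orders R i on ℕ.
Sumℕ : Rel ℕ 0ℓ → (ℕ → Rel ℕ 0ℓ) → Rel ℕ 0ℓ
Sumℕ _≤_ R = Via unpair (Lex _≤_ R)

Sumℕ-isTotalOrder : ExcludedMiddle → {_≤_ : Rel ℕ 0ℓ} {R : ℕ → Rel ℕ 0ℓ} →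
  IsTotalOrder _≡_ _≤_ → (∀ i → IsTotalOrder _≡_ (R i)) →
  IsTotalOrder _≡_ (Sumℕ _≤_ R)
Sumℕ-isTotalOrder lem to R-to =
  ViaProperties.isTotalOrder unpair-injective (LexProperties.isTotalOrder to lem R-to)

module _ {_≤_ : Rel ℕ 0ℓ} {R : ℕ → Rel ℕ 0ℓ} where

  Lex⇒Sumℕ : ∀ {i m j n} → Lex _≤_ R (i , m) (j , n) → Sumℕ _≤_ R (pair i m) (pair j n)
  Lex⇒Sumℕ {i} {m} {j} {n} =
    via ∘ subst₂ (Lex _≤_ R) (sym (unpair-pair i m)) (sym (unpair-pair j n))

  Sumℕ⇒Lex : ∀ {i m j n} → Sumℕ _≤_ R (pair i m) (pair j n) → Lex _≤_ R (i , m) (j , n)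
  Sumℕ⇒Lex {i} {m} {j} {n} (via p) =
    subst₂ (Lex _≤_ R) (unpair-pair i m) (unpair-pair j n) p

-- R followed by the numbers outside its field in their natural order. In new, n
-- is outside the field, and m is inside it or precedes n.
data Complete (R : Rel ℕ 0ℓ) : Rel ℕ 0ℓ where
  old : ∀ {m n} → R m n → Complete R m n
  new : ∀ {m n} → ¬ R n n → R m m ⊎ m ≤ n → Complete R m n

module _ (lem : ExcludedMiddle) {R : Rel ℕ 0ℓ} (R-lin : IsLinearOnField R) where
  open IsLinearOnField R-lin

  Complete-isTotalOrder : IsTotalOrder _≡_ (Complete R)
  Complete-isTotalOrder = isTotalOrder≡ C-refl C-trans C-antisym C-total
    where
    C-refl : ∀ n → Complete R n n
    C-refl n with lem (R n n)
    ... | yes p = old p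
    ... | no ¬p = new ¬p (inj₂ ℕ.≤-refl)

    C-trans : Transitive (Complete R)
    C-trans (old p) (old q) = old (transitive p q)
    C-trans (old p) (new k∉ _) = new k∉ (inj₁ (left p))
    C-trans (new j∉ _) (old q) = contradiction (left q) j∉
    C-trans (new j∉ (inj₁ p)) (new k∉ _) = new k∉ (inj₁ p)
    C-trans (new j∉ (inj₂ p)) (new k∉ (inj₁ q)) = contradiction q j∉
    C-trans (new j∉ (inj₂ p)) (new k∉ (inj₂ q)) = new k∉ (inj₂ (ℕ.≤-trans p q))

    C-antisym : Antisymmetric _≡_ (Complete R)
    C-antisym (old p) (old q) = antisym p q
    C-antisym (old p) (new i∉ _) = contradiction (left p) i∉
    C-antisym (new j∉ _) (old q) = contradiction (left q) j∉
    C-antisym (new j∉ (inj₁ p)) (new i∉ _) = contradiction p i∉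
    C-antisym (new j∉ (inj₂ p)) (new i∉ (inj₁ q)) = contradiction q j∉
    C-antisym (new j∉ (inj₂ p)) (new i∉ (inj₂ q)) = ℕ.≤-antisym p q

    C-total : Total (Complete R)
    C-total m n with lem (R m m) | lem (R n n)
    ... | yes p | yes q = [ inj₁ ∘ old , inj₂ ∘ old ]′ (total p q)
    ... | yes p | no ¬q = inj₁ (new ¬q (inj₁ p))
    ... | no ¬p | yes q = inj₂ (new ¬p (inj₁ q))
    ... | no ¬p | no ¬q =
      [ inj₁ ∘ new ¬q ∘ inj₂ , inj₂ ∘ new ¬p ∘ inj₂ ]′ (ℕ.≤-total m n)

  Complete-wellFounded : WellFounded (Strict R) → WellFounded (Strict (Complete R))
  Complete-wellFounded wf n =
    [ (λ n∈ → inside n∈ (wf n)) , (λ n∉ → outside n∉ (<-wellFounded n)) ]′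
      (toSum (lem (R n n)))
    where
    inside : ∀ {n} → R n n → Acc (Strict R) n → Acc (Strict (Complete R)) n
    inside n∈ (acc rs) = acc λ
      { (old p , ne) → inside (left p) (rs (p , ne))
      ; (new n∉ _ , _) → contradiction n∈ n∉
      }

    outside : ∀ {n} → ¬ R n n → Acc _<_ n → Acc (Strict (Complete R)) n
    outside {n} n∉ (acc rs) = acc below
      where
      below : ∀ {m} → Strict (Complete R) m n → Acc (Strict (Complete R)) m
      below (old p , _) = contradiction (right p) n∉
      below {m} (new _ c , ne) with lem (R m m) | c
      ... | yes m∈ | _ = inside m∈ (wf m)
      ... | no m∉ | inj₁ m∈ = contradiction m∈ m∉
      ... | no m∉ | inj₂ m≤n = outside m∉ (rs (ℕ.≤∧≢⇒< m≤n ne))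

------------------------------------------------------------------------
-- Well-orders and their spreads over the rationals

-- R moved to the positive numbers.
data Shift (R : Rel ℕ 0ℓ) : Rel ℕ 0ℓ where
  shift : ∀ {m n} → R m n → Shift R (suc m) (suc n)

Shift-isLinearOnField : ∀ {R} → IsLinearOnField R → IsLinearOnField (Shift R)
Shift-isLinearOnField {R} lin = record
  { left = λ { (shift p) → shift (left p) }
  ; right = λ { (shift p) → shift (right p) }
  ; transitive = λ { (shift p) (shift q) → shift (transitive p q) }
  ; antisym = λ { (shift p) (shift q) → cong suc (antisym p q) }
  ; total = λ { (shift p) (shift q) → [ inj₁ ∘ shift , inj₂ ∘ shift ]′ (total p q) }
  }
  where open IsLinearOnField lin

Shift-wellFounded : ∀ {R} → WellFounded (Strict R) → WellFounded (Strict (Shift R))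
Shift-wellFounded {R} wf zero = acc λ { (() , _) }
Shift-wellFounded {R} wf (suc n) = go (wf n)
  where
  go : ∀ {n} → Acc (Strict R) n → Acc (Strict (Shift R)) (suc n)
  go (acc rs) = acc λ { (shift p , ne) → go (rs (p , ne ∘ cong suc)) }

-- R, moved to the positive numbers, followed by 0, followed by the positive
-- numbers not coming from R. The element 0 lies just above R, and its position
-- makes the field of R recoverable, so that Hat R determines R.
Hat : Rel ℕ 0ℓ → Rel ℕ 0ℓ
Hat R = Complete (Shift R)

Hat-isTotalOrder : ExcludedMiddle → ∀ {R} → IsLinearOnField R → IsTotalOrder _≡_ (Hat R)
Hat-isTotalOrder lem lin = Complete-isTotalOrder lem (Shift-isLinearOnField lin)

Hat-wellFounded : ExcludedMiddle → ∀ {R} → IsLinearOnField R →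
                  WellFounded (Strict R) → WellFounded (Strict (Hat R))
Hat-wellFounded lem lin wf =
  Complete-wellFounded lem (Shift-isLinearOnField lin) (Shift-wellFounded wf)

Hat-suc : ∀ {R m n} → Strict R m n → Strict (Hat R) (suc m) (suc n)
Hat-suc (p , ne) = old (shift p) , ne ∘ ℕ.suc-injective

Hat-<0 : ∀ {R n} → R n n → Strict (Hat R) (suc n) zero
Hat-<0 p = new (λ ()) (inj₁ (shift p)) , λ ()

Hat-determines : ∀ {R S} → IsLinearOnField R → (∀ {m n} → Hat R m n → Hat S m n) →
                 ∀ {m n} → R m n → S m n
Hat-determines {R} {S} lin R⇒S {m} {n} p = order (R⇒S (old (shift p)))
  where
  field-S : Hat S (suc n) zero → S n n
  field-S (new _ (inj₁ (shift q))) = q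

  order : Hat S (suc m) (suc n) → S m n
  order (old (shift q)) = q
  order (new n∉ _) = contradiction
    (shift (field-S (R⇒S (proj₁ (Hat-<0 (IsLinearOnField.right lin p)))))) n∉

-- An enumeration of the integers by pairs: the first component holds the sign.
integer : ℕ × ℕ → ℤ
integer (zero  , n) = + n
integer (suc _ , n) = -[1+ n ]

-- An enumeration of the rationals, with repetitions.
rational : ℕ → ℚ
rational k = fromℚᵘ (mkℚᵘ (integer (unpair (proj₁ (unpair k)))) (proj₂ (unpair k)))

-- A right inverse of the enumeration of the rationals.
index : ℚ → ℕ
index (ℚ.mkℚ (+ n) d _)      = pair (pair 0 n) d
index (ℚ.mkℚ (-[1+ n ]) d _) = pair (pair 1 n) d

rational-index : ∀ q → rational (index q) ≡ q
rational-index q@(ℚ.mkℚ (+ n) d _) rewrite unpair-pair (pair 0 n) d | unpair-pair 0 n =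
  ℚ.fromℚᵘ-toℚᵘ q
rational-index q@(ℚ.mkℚ (-[1+ n ]) d _) rewrite unpair-pair (pair 1 n) d | unpair-pair 1 n =
  ℚ.fromℚᵘ-toℚᵘ q

-- ℕ ordered by the rational that a number enumerates, repetitions being
-- ordered naturally. The rationals embed in it.
Rational≤ : Rel ℕ 0ℓ
Rational≤ = Via (λ k → rational k , k) (Lex ℚ._≤_ (λ _ → _≤_))

Rational≤-isTotalOrder : ExcludedMiddle → IsTotalOrder _≡_ Rational≤
Rational≤-isTotalOrder lem = ViaProperties.isTotalOrder (cong proj₂)
  (LexProperties.isTotalOrder ℚ.≤-isTotalOrder lem (λ _ → ℕ.≤-isTotalOrder))

index-mono : ∀ {p q} → Strict ℚ._≤_ p q → Strict Rational≤ (index p) (index q)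
index-mono {p} {q} p<q =
  via (across (subst₂ (Strict ℚ._≤_) (sym (rational-index p)) (sym (rational-index q)) p<q)) ,
  λ e → proj₂ p<q (trans (sym (rational-index p)) (trans (cong rational e) (rational-index q)))

-- A copy of R for every number, the copies being ordered by Rational≤.
Spread : Rel ℕ 0ℓ → Rel ℕ 0ℓ
Spread R = Sumℕ Rational≤ (λ _ → R)

Spread-isTotalOrder : ExcludedMiddle → ∀ {R} → IsTotalOrder _≡_ R → IsTotalOrder _≡_ (Spread R)
Spread-isTotalOrder lem R-to =
  Sumℕ-isTotalOrder lem (Rational≤-isTotalOrder lem) (λ _ → R-to)

------------------------------------------------------------------------
-- Piecewise convex embeddings of spreads

Lin-isLinear : (K : Lin) → IsLinear (proj₁ K)
Lin-isLinear (_ , inj₁ (lin , _)) = lin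
Lin-isLinear (_ , inj₂ (lin , _)) = lin

-- The blocks of a convex partition are convex.
block-convex : ExcludedMiddle → ∀ {K L block} → IsLinear K → IsLinear L →
               IsConvexPartition K L block → ∀ k → Convex L (block k)
block-convex lem {K} {L} {block} K-lin L-lin part k {p} {q} {r} p≤q q≤r p∈ r∈
  with IsConvexPartition.cover part q
... | j , q∈ with connex lem (IsLinear.isTotalOrder K-lin) k j
...   | inj₂ (inj₁ refl) = q∈
...   | inj₁ k<j = contradiction q≤r (ToStrict.<⇒≱ _≡_ (Le L)
        (IsTotalOrder.antisym (IsLinear.isTotalOrder L-lin))
        (Equivalence.to (IsConvexPartition.ordered part) k<j r∈ q∈))
...   | inj₂ (inj₂ j<k) = contradiction p≤q (ToStrict.<⇒≱ _≡_ (Le L)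
        (IsTotalOrder.antisym (IsLinear.isTotalOrder L-lin))
        (Equivalence.to (IsConvexPartition.ordered part) j<k q∈ p∈))

-- An embedding with convex range.
ConvexlyEmbeds : Rel ℕ 0ℓ → Rel ℕ 0ℓ → Set
ConvexlyEmbeds R S = Σ (ℕ → ℕ) λ g →
  (∀ {m n} → Strict R m n → Strict S (g m) (g n)) ×
  (∀ {m n y} → S (g m) y → S y (g n) → Σ ℕ λ k → y ≡ g k)

-- A partition of a spread indexed by a scattered order has a block that meets
-- two copies with distinct rationals, for otherwise the rationals would embed
-- in the index order. That block contains a whole copy.
module _ (lem : ExcludedMiddle) {𝓛 : Pred Lin ℓ} (𝓛⊆Scat : 𝓛 ⊆ Scat)
  {R : Rel ℕ 0ℓ} (R-to : IsTotalOrder _≡_ R) (L′ : LO) where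

  private
    M : LO
    M = toLO lem (Spread R) (Spread-isTotalOrder lem R-to)

    point : ℕ → ℕ → Dom (proj₁ M)
    point i n = element M (pair i n)

    point-≤ : ∀ {i m j n} → Lex Rational≤ (λ _ → R) (i , m) (j , n) →
              Le (proj₁ M) (point i m) (point j n)
    point-≤ p = codeOf∋ lem (Lex⇒Sumℕ p)

    point-Lex : ∀ {i m j n} → Le (proj₁ M) (point i m) (point j n) →
                Lex Rational≤ (λ _ → R) (i , m) (j , n)
    point-Lex p = Sumℕ⇒Lex (∈codeOf lem p)

    copy-convex : ∀ {i m j k n} → Le (proj₁ M) (point i m) (point j k) →
                  Le (proj₁ M) (point j k) (point i n) → i ≡ j
    copy-convex {i} {m} {j} {k} {n} p q = LexProperties.between
      (Rational≤-isTotalOrder lem) (point-Lex p) (point-Lex q)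

    point-surjective : ∀ x → ∃ λ i → ∃ λ n → x ≡ point i n
    point-surjective (k , _) = _ , _ , Dom-≡ {proj₁ M} (sym (pair-unpair k))

    point-injectiveʳ : ∀ {i m n} → point i m ≡ point i n → m ≡ n
    point-injectiveʳ {i} {m} {n} e = cong proj₂
      (trans (sym (unpair-pair i m)) (trans (cong (unpair ∘ proj₁) e) (unpair-pair i n)))

    M-to : IsTotalOrder _≡_ (Le (proj₁ M))
    M-to = IsLinear.isTotalOrder (proj₁ (proj₂ M))

  copy-convexlyEmbeds : ⊴LO 𝓛 M L′ → ConvexlyEmbeds R ⟦ proj₁ L′ ⟧
  copy-convexlyEmbeds (K , K∈𝓛 , block , part , f , f-emb , f-convex) =
    byCases (lem (∃ λ p → ∃ λ q → p ℚ.< q × at p ≡ at q))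
    where
    K-lin : IsLinear (proj₁ K)
    K-lin = Lin-isLinear K

    at : ℚ → Dom (proj₁ K)
    at q = proj₁ (IsConvexPartition.cover part (point (index q) 0))

    at∋ : ∀ q → point (index q) 0 ∈ block (at q)
    at∋ q = proj₂ (IsConvexPartition.cover part (point (index q) 0))

    byCases : Dec (∃ λ p → ∃ λ q → p ℚ.< q × at p ≡ at q) → ConvexlyEmbeds R ⟦ proj₁ L′ ⟧
    byCases (no separated) = contradiction (at , at-emb) (𝓛⊆Scat K∈𝓛)
      where
      at-mono : ∀ {p q} → Strict ℚ._≤_ p q → Strict (Le (proj₁ K)) (at p) (at q)
      at-mono {p} {q} p<q@(p≤q , ne) with connex lem (IsLinear.isTotalOrder K-lin) (at p) (at q)
      ... | inj₁ lt = lt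
      ... | inj₂ (inj₁ e) = contradiction (p , q , ℚ.≰⇒> (ne ∘ ℚ.≤-antisym p≤q) , e) separated
      ... | inj₂ (inj₂ gt) = contradiction (point-≤ (across (index-mono p<q)))
        (ToStrict.<⇒≱ _≡_ (Le (proj₁ M)) (IsTotalOrder.antisym M-to)
          (Equivalence.to (IsConvexPartition.ordered part) gt (at∋ q) (at∋ p)))

      at-emb : IsOrderMonomorphism _≡_ _≡_ ℚ._≤_ (Le (proj₁ K)) at
      at-emb = strictlyMonotone⇒embedding lem ℚ.≤-isTotalOrder
        (IsLinear.isTotalOrder K-lin) at-mono

    -- The copy in question is that of a rational between p and q.
    byCases (yes (p , q , p<q , same)) = proj₁ ∘ f ∘ point i , mono , convex
      where
      i : ℕ
      i = index (proj₁ (ℚ.<-dense p<q))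

      strict : ∀ {r s} → r ℚ.< s → Strict Rational≤ (index r) (index s)
      strict r<s = index-mono (ℚ.<⇒≤ r<s , ℚ.<⇒≢ r<s)

      copy⊆block : ∀ n → point i n ∈ block (at p)
      copy⊆block n = block-convex lem K-lin (proj₁ (proj₂ M)) part (at p)
        (point-≤ (across (strict (proj₁ (proj₂ (ℚ.<-dense p<q))))))
        (point-≤ (across (strict (proj₂ (proj₂ (ℚ.<-dense p<q))))))
        (at∋ p) (subst (λ k → point (index q) 0 ∈ block k) (sym same) (at∋ q))

      mono : ∀ {m n} → Strict R m n →
             Strict ⟦ proj₁ L′ ⟧ (proj₁ (f (point i m))) (proj₁ (f (point i n)))
      mono (m≤n , ne) = IsOrderMonomorphism.mono f-emb (point-≤ (within m≤n)) ,
        λ e → ne (point-injectiveʳ (IsOrderMonomorphism.injective f-emb (Dom-≡ {proj₁ L′} e)))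

      convex : ∀ {m n y} → ⟦ proj₁ L′ ⟧ (proj₁ (f (point i m))) y →
               ⟦ proj₁ L′ ⟧ y (proj₁ (f (point i n))) → ∃ λ k → y ≡ proj₁ (f (point i k))
      convex {m} {n} {y} fm≤y y≤fn
        with f-convex (at p) {q = element L′ y} fm≤y y≤fn
               (_ , copy⊆block m , refl) (_ , copy⊆block n , refl)
      ... | x , _ , fx≡y with point-surjective x
      ...   | j , k , refl with copy-convex {i} {m} {j} {k} {n}
                (IsOrderMonomorphism.cancel f-emb
                  (subst (Le (proj₁ L′) (f (point i m))) (sym fx≡y) fm≤y))
                (IsOrderMonomorphism.cancel f-emb
                  (subst (λ z → Le (proj₁ L′) z (f (point i n))) (sym fx≡y) y≤fn))
      ...     | refl = k , sym (cong proj₁ fx≡y)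

------------------------------------------------------------------------
-- A well-order too long for the well-ordered convex subsets

module _ (lem : ExcludedMiddle) {S : Rel ℕ 0ℓ} (S-to : IsTotalOrder _≡_ S) where

  private
    -- The element y lies strictly below z and not below x.
    From : ℕ → Rel ℕ 0ℓ
    From x y z = S x y × Strict S y z

  -- The y above x such that the interval from x to y is well-ordered, expressed
  -- as accessibility of y.
  WellOrderedFrom : ℕ → Pred ℕ 0ℓ
  WellOrderedFrom x y = S x y × Acc (From x) y

  -- The longest well-ordered convex set with least element x.
  Segment : ℕ → Rel ℕ 0ℓ
  Segment x m n = WellOrderedFrom x m × WellOrderedFrom x n × S m n

  Segment-isLinearOnField : ∀ x → IsLinearOnField (Segment x)
  Segment-isLinearOnField x = record
    { left = λ (p , _ , _) → p , p , IsTotalOrder.refl S-to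
    ; right = λ (_ , q , _) → q , q , IsTotalOrder.refl S-to
    ; transitive = λ (p , _ , l) (_ , q , l′) → p , q , IsTotalOrder.trans S-to l l′
    ; antisym = λ (_ , _ , l) (_ , _ , l′) → IsTotalOrder.antisym S-to l l′
    ; total = λ {m} {n} (p , _ , _) (q , _ , _) →
        [ (λ l → inj₁ (p , q , l)) , (λ l → inj₂ (q , p , l)) ]′ (IsTotalOrder.total S-to m n)
    }

  Segment-wellFounded : ∀ x → WellFounded (Strict (Segment x))
  Segment-wellFounded x n = acc λ { ((m∈ , _ , _) , _) → go (proj₂ m∈) }
    where
    go : ∀ {n} → Acc (From x) n → Acc (Strict (Segment x)) n
    go (acc rs) = acc λ { ((m∈ , _ , m≤n) , ne) → go (rs (proj₁ m∈ , m≤n , ne)) }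

  -- The sum over x of all segments, each extended by a top element.
  Long : Rel ℕ 0ℓ
  Long = Sumℕ _≤_ (λ x → Hat (Segment x))

  Long-isTotalOrder : IsTotalOrder _≡_ Long
  Long-isTotalOrder = Sumℕ-isTotalOrder lem ℕ.≤-isTotalOrder
    (λ x → Hat-isTotalOrder lem (Segment-isLinearOnField x))

  Long-wellFounded : WellFounded (Strict Long)
  Long-wellFounded = ViaProperties.wellFounded unpair-injective
    (LexProperties.wellFounded ℕ.≤-isTotalOrder
      (Subrelation.wellFounded (λ (m≤n , ne) → ℕ.≤∧≢⇒< m≤n ne) <-wellFounded)
      (λ x → Hat-wellFounded lem (Segment-isLinearOnField x) (Segment-wellFounded x)))

  -- A well-order embedded with convex range lies in the segment of the image of
  -- its least element.
  convexlyEmbeds⇒segment : ∀ {W} → IsTotalOrder _≡_ W → WellFounded (Strict W) →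
    ((g , _) : ConvexlyEmbeds W S) → ∃ λ x → ∀ n → WellOrderedFrom x (g n)
  convexlyEmbeds⇒segment {W} W-to W-wf (g , mono , convex)
    with minimal lem W-wf (λ _ → ⊤) (zero , tt)
  ... | b , _ , b-min = g b , λ n → above n , go n (W-wf n)
    where
    g-emb : IsOrderMonomorphism _≡_ _≡_ W S g
    g-emb = strictlyMonotone⇒embedding lem W-to S-to mono

    above : ∀ n → S (g b) (g n)
    above n with connex lem W-to b n
    ... | inj₁ b<n = proj₁ (mono b<n)
    ... | inj₂ (inj₁ refl) = IsTotalOrder.refl S-to
    ... | inj₂ (inj₂ n<b) = contradiction tt (b-min n<b)

    go : ∀ n → Acc (Strict W) n → Acc (From (g b)) (g n)
    go n (acc rs) = acc below
      where
      below : ∀ {y} → From (g b) y (g n) → Acc (From (g b)) y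
      below (b≤y , y≤n , ne) with convex b≤y y≤n
      ... | k , refl = go k (rs (IsOrderMonomorphism.cancel g-emb y≤n , ne ∘ cong g))

  -- No well-order W in which Long embeds is embedded in S with convex range.
  -- Otherwise W lies in some segment. The summand of Long belonging to this
  -- segment is the segment with an extra element on top, and sending that summand
  -- through W into the segment takes the image of the top to a smaller element.
  Long-¬convexlyEmbeds : ∀ {W} → IsTotalOrder _≡_ W → WellFounded (Strict W) →
    (h : ℕ → ℕ) → (∀ {m n} → Strict Long m n → Strict W (h m) (h n)) →
    ¬ ConvexlyEmbeds W S
  Long-¬convexlyEmbeds W-to W-wf h h-mono emb@(g , g-mono , _)
    with convexlyEmbeds⇒segment W-to W-wf emb
  ... | x , inside = strictlyMonotone⇒¬< (Segment-wellFounded x) (F ∘ suc)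
          (F-mono ∘ Hat-suc) (F zero)
          (F-mono (Hat-<0 (inside _ , inside _ , IsTotalOrder.refl S-to)))
    where
    F : ℕ → ℕ
    F n = g (h (pair x n))

    F-mono : ∀ {m n} → Strict (Hat (Segment x)) m n → Strict (Segment x) (F m) (F n)
    F-mono {m} {n} (m≤n , ne) = (inside _ , inside _ , proj₁ lt) , proj₂ lt
      where
      lt : Strict S (F m) (F n)
      lt = g-mono (h-mono (Lex⇒Sumℕ (within m≤n) , λ e → ne (cong proj₂
        (trans (sym (unpair-pair x m)) (trans (cong unpair e) (unpair-pair x n))))))

------------------------------------------------------------------------
-- An unbounded family indexed by the countable ordinals

-- Pointwise equality of codes, the equality of LO.
infix 4 _≐_
_≐_ : Rel Code 0ℓ
c ≐ d = ∀ x → c x ≡ d x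

sameOrder⇒≅ : ∀ {c d} → (∀ {m n} → ⟦ c ⟧ m n → ⟦ d ⟧ m n) →
      (∀ {m n} → ⟦ d ⟧ m n → ⟦ c ⟧ m n) → c ≅ d
sameOrder⇒≅ {c} {d} c⇒d d⇒c = (λ (n , p) → n , c⇒d p) , record
  { isOrderMonomorphism = record
    { isOrderHomomorphism = record { cong = cong _ ; mono = c⇒d }
    ; injective = λ e → Dom-≡ {c} (cong proj₁ e)
    ; cancel = d⇒c
    }
  ; surjective = λ (n , p) → (n , d⇒c p) , λ { refl → Dom-≡ {d} refl }
  }

-- The countable ordinals as codes.
Ordinal : Set
Ordinal = Setoid.Carrier ω₁

module _ (lem : ExcludedMiddle) where

  -- Hat α repeated densely, as a member of LO.
  spread : Ordinal → LO
  spread (c , lin , _) = toLO lem (Spread (Hat ⟦ c ⟧))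
    (Spread-isTotalOrder lem (Hat-isTotalOrder lem (code-isLinearOnField lin)))

  -- The order of α is read off from the copy of Hat α with index 0.
  spread-≤ : ∀ α β → proj₁ (spread α) ≐ proj₁ (spread β) →
    ∀ {m n} → ⟦ proj₁ α ⟧ m n → ⟦ proj₁ β ⟧ m n
  spread-≤ (c , lin , _) (d , _) e = Hat-determines (code-isLinearOnField lin) hat
    where
    drop : ∀ {R m n} → Lex Rational≤ (λ _ → R) (0 , m) (0 , n) → R m n
    drop (across (_ , ne)) = contradiction refl ne
    drop (within p) = p

    hat : ∀ {m n} → Hat ⟦ c ⟧ m n → Hat ⟦ d ⟧ m n
    hat {m} {n} p = drop (Sumℕ⇒Lex (∈codeOf lem
      (subst T (e (pair 0 m , pair 0 n)) (codeOf∋ lem (Lex⇒Sumℕ (within p))))))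

  spread-injective : ∀ α β → proj₁ (spread α) ≐ proj₁ (spread β) → proj₁ α ≅ proj₁ β
  spread-injective α β e = sameOrder⇒≅ (spread-≤ α β e) (spread-≤ β α (sym ∘ e))

  -- The statement covers all ordinals isomorphic to α because the family uses the
  -- spread of a representative of α.
  spread-unbounded : {𝓛 : Pred Lin ℓ} → 𝓛 ⊆ Scat → (L′ : LO) →
    ∃ λ α → ∀ β → proj₁ α ≅ proj₁ β → ¬ ⊴LO 𝓛 (spread β) L′
  spread-unbounded {𝓛 = 𝓛} 𝓛⊆Scat L′ = α , beyond
    where
    L′-to : IsTotalOrder _≡_ ⟦ proj₁ L′ ⟧
    L′-to = LO-isTotalOrder L′

    longLO : LO
    longLO = toLO lem (Long lem L′-to) (Long-isTotalOrder lem L′-to)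

    α : Ordinal
    α = proj₁ longLO , proj₁ (proj₂ longLO) , codeOf-wellFounded lem (Long-wellFounded lem L′-to)

    beyond : ∀ β → proj₁ α ≅ proj₁ β → ¬ ⊴LO 𝓛 (spread β) L′
    beyond (c , lin , wf) (h , h-iso) below =
      Long-¬convexlyEmbeds lem L′-to {Hat ⟦ c ⟧} Hat-to
        (Hat-wellFounded lem c-lin (code-wellFounded lin wf)) g g-mono
        (copy-convexlyEmbeds lem 𝓛⊆Scat Hat-to L′ below)
      where
      c-lin : IsLinearOnField ⟦ c ⟧
      c-lin = code-isLinearOnField lin

      Hat-to : IsTotalOrder _≡_ (Hat ⟦ c ⟧)
      Hat-to = Hat-isTotalOrder lem c-lin

      g : ℕ → ℕ
      g n = suc (proj₁ (h (element longLO n)))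

      g-mono : ∀ {m n} → Strict (Long lem L′-to) m n → Strict (Hat ⟦ c ⟧) (g m) (g n)
      g-mono (m≤n , ne) = Hat-suc
        (IsOrderIsomorphism.mono h-iso (codeOf∋ lem m≤n) ,
         λ e → ne (cong proj₁ (IsOrderIsomorphism.injective h-iso (Dom-≡ {c} e))))

-- A choice of representatives of the isomorphism classes of countable ordinals.
representative : Choice → Σ (Ordinal → Ordinal) λ r →
  (∀ α → proj₁ (r α) ≅ proj₁ α) × (∀ {α β} → proj₁ α ≅ proj₁ β → r α ≡ r β)
representative ac with ac quotient
  where
  quotient : Surjection (setoid Ordinal) ω₁
  quotient = record
    { to = id
    ; cong = λ { refl → ≅-refl }
    ; surjective = λ α → α , λ { refl → ≅-refl }
    }
... | g , section = Func.to g , section , Func.cong g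

-- The spreads of the representatives. Passing to representatives makes the map
-- from ordinals to codes respect isomorphism.
unboundedFamily : Choice → {𝓛 : Pred Lin ℓ} → 𝓛 ⊆ Scat →
  Σ (Subset LO-setoid) λ F → HasSize LO-setoid F ω₁ × Unbounded LO-setoid (⊴LO 𝓛) F
unboundedFamily ac {𝓛} 𝓛⊆Scat with representative ac
... | r , r≅ , r-cong = F , size , unbounded
  where
  lem : ExcludedMiddle
  lem = excludedMiddle ac

  F : Subset LO-setoid
  F = record
    { member = λ L → ∃ λ α → proj₁ L ≐ proj₁ (spread lem (r α))
    ; respects = λ e (α , e′) → α , λ x → trans (sym (e x)) (e′ x)
    }

  size : HasSize LO-setoid F ω₁
  size = record
    { to = λ α → spread lem (r α) , α , λ _ → refl
    ; cong = λ α≅β x → cong (λ γ → proj₁ (spread lem γ) x) (r-cong α≅β)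
    ; bijective =
        (λ {α} {β} e → ≅-trans (≅-sym (r≅ α))
          (≅-trans (spread-injective lem (r α) (r β) e) (r≅ β))) ,
        λ (L , α , e) → α , λ β≅α x →
          trans (cong (λ γ → proj₁ (spread lem γ) x) (r-cong β≅α)) (sym (e x))
    }

  unbounded : Unbounded LO-setoid (⊴LO 𝓛) F
  unbounded (L′ , bound) with spread-unbounded lem 𝓛⊆Scat L′
  ... | α , beyond = beyond (r α) (≅-sym (r≅ α)) (bound (spread lem (r α)) (α , λ _ → refl))

------------------------------------------------------------------------
-- Countable families are bounded

-- The order with 0 as its only element.
singleton : Code
singleton (zero , zero) = true
singleton _             = false

singleton-unique : (p q : Dom singleton) → p ≡ q
singleton-unique (zero , _) (zero , _) = refl

singletonLin : Lin
singletonLin = singleton , inj₁ (record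
  { field-⊆-Dom = λ { {zero} {zero} _ → tt , tt }
  ; isTotalOrder = isTotalOrder≡ (λ (_ , p) → p)
      (λ { {zero , _} {zero , _} {zero , _} _ _ → tt })
      (λ {p} {q} _ _ → singleton-unique p q)
      (λ { (zero , _) (zero , _) → inj₁ tt })
  } , (zero , tt) , 1 , λ { (zero , _) → s≤s z≤n })

inhabited : (K : Lin) → Dom (proj₁ K)
inhabited (_ , inj₁ (_ , x , _)) = x
inhabited (_ , inj₂ (_ , full)) = zero , full zero

singletonLin-≼ : ∀ K → singletonLin ≼ K
singletonLin-≼ K = (λ _ → inhabited K) , record
  { isOrderHomomorphism = record
    { cong = λ _ → refl
    ; mono = λ _ → IsTotalOrder.refl (IsLinear.isTotalOrder (Lin-isLinear K)) {inhabited K}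
    }
  ; injective = λ {p} {q} _ → singleton-unique p q
  ; cancel = λ { {zero , _} {zero , _} _ → tt }
  }

module _ (lem : ExcludedMiddle) {𝓛 : Pred Lin ℓ}
  (nonempty : Satisfiable 𝓛) (down : DownwardClosed 𝓛) where

  -- The sum of the L i over the natural numbers contains each L i as a convex
  -- subset, so a partition into a single block suffices.
  sum-bounds : (L : ℕ → LO) → ∃ λ u → ∀ i y → proj₁ y ≐ proj₁ (L i) → ⊴LO 𝓛 y u
  sum-bounds L = u , below
    where
    R : ℕ → Rel ℕ 0ℓ
    R i = ⟦ proj₁ (L i) ⟧

    u-to : IsTotalOrder _≡_ (Sumℕ _≤_ R)
    u-to = Sumℕ-isTotalOrder lem ℕ.≤-isTotalOrder (λ i → LO-isTotalOrder (L i))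

    u : LO
    u = toLO lem (Sumℕ _≤_ R) u-to

    below : ∀ i y → proj₁ y ≐ proj₁ (L i) → ⊴LO 𝓛 y u
    below i y e = singletonLin , down (singletonLin-≼ (proj₁ nonempty)) (proj₂ nonempty) ,
      (λ _ _ → ⊤) , partition , f , f-emb , λ _ → f-convex
      where
      partition : IsConvexPartition singleton (proj₁ y) (λ _ _ → ⊤)
      partition = record
        { nonempty = λ _ → element y zero , tt
        ; cover = λ _ → (zero , tt) , tt
        ; disjoint = λ {p} {q} _ _ → singleton-unique p q
        ; ordered = λ {p} {q} → mk⇔ (λ p<q → contradiction (singleton-unique p q) (proj₂ p<q))
            (λ lt → contradiction refl (proj₂ (lt {element y zero} {element y zero} tt tt)))
        }

      f : Dom (proj₁ y) → Dom (proj₁ u)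
      f (m , _) = element u (pair i m)

      cancel : ∀ {m n} → Sumℕ _≤_ R (pair i m) (pair i n) → ⟦ proj₁ y ⟧ m n
      cancel {m} {n} p with Sumℕ⇒Lex p
      ... | across (_ , ne) = contradiction refl ne
      ... | within q = subst T (sym (e (m , n))) q

      f-emb : IsOrderMonomorphism _≡_ _≡_ (Le (proj₁ y)) (Le (proj₁ u)) f
      f-emb = record
        { isOrderHomomorphism = record
          { cong = cong f
          ; mono = λ {p} {q} p≤q → codeOf∋ lem
              (Lex⇒Sumℕ (within (subst T (e (proj₁ p , proj₁ q)) p≤q)))
          }
        ; injective = λ {p} {q} e → Dom-≡ {proj₁ y} (cong proj₂
            (trans (sym (unpair-pair i (proj₁ p)))
              (trans (cong (unpair ∘ proj₁) e) (unpair-pair i (proj₁ q)))))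
        ; cancel = λ p≤q → cancel (∈codeOf lem p≤q)
        }

      f-convex : Convex (proj₁ u) (Image f (λ _ → ⊤))
      f-convex {_} {k , _} {_} p q ((m , _) , _ , refl) ((n , _) , _ , refl)
        with refl ← LexProperties.between {R = R} ℕ.≤-isTotalOrder
          (subst (λ x → Lex _≤_ R x (unpair k)) (unpair-pair i m) (Via.at (∈codeOf lem p)))
          (subst (Lex _≤_ R (unpair k)) (unpair-pair i n) (Via.at (∈codeOf lem q))) =
        element y (proj₂ (unpair k)) , tt , Dom-≡ {proj₁ u} (pair-unpair k)

  -- A family indexed by a countable set is bounded; a number outside the index
  -- set is assigned an arbitrary order.
  countable-bounded : ∀ (c : Code) (L : Dom c → LO) →
    ∃ λ u → ∀ x y → proj₁ y ≐ proj₁ (L x) → ⊴LO 𝓛 y u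
  countable-bounded c L = proj₁ bound , λ (n , t) y e →
    proj₂ bound n y (subst (λ M → proj₁ y ≐ proj₁ M) (assign-≡ n t) e)
    where
    assign : ℕ → LO
    assign n with T? (c (n , n))
    ... | yes t = L (n , t)
    ... | no _  = toLO lem _≤_ ℕ.≤-isTotalOrder

    assign-≡ : ∀ n t → L (n , t) ≡ assign n
    assign-≡ n t with T? (c (n , n))
    ... | yes t′ = cong (λ p → L (n , p)) (T-irrelevant t t′)
    ... | no ¬t = contradiction t ¬t

    bound : ∃ λ u → ∀ n y → proj₁ y ≐ proj₁ (assign n) → ⊴LO 𝓛 y u
    bound = sum-bounds assign

------------------------------------------------------------------------
-- Comparing well-orders

-- Elements of two well-orders having the same rank: every element below one of
-- them has the same rank as some element below the other. As the orders are
-- well-founded, the inductive definition loses no instances.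
data SameRank (c d : Code) (x : Dom c) (y : Dom d) : Set where
  sameRank : (∀ {x′} → Lt c x′ x → ∃ λ y′ → Lt d y′ y × SameRank c d x′ y′) →
             (∀ {y′} → Lt d y′ y → ∃ λ x′ → Lt c x′ x × SameRank c d x′ y′) →
             SameRank c d x y

-- Every element of c has the rank of some element of d.
RanksWithin : (c d : Code) → Set
RanksWithin c d = ∀ x → ∃ (SameRank c d x)

module _ {c d : Code} where

  SameRank-sym : WellFounded (Lt c) → ∀ {x y} → SameRank c d x y → SameRank d c y x
  SameRank-sym wf = go (wf _)
    where
    go : ∀ {x y} → Acc (Lt c) x → SameRank c d x y → SameRank d c y x
    go (acc rs) (sameRank l r) = sameRank
      (λ y′<y → let x′ , x′<x , e = r y′<y in x′ , x′<x , go (rs x′<x) e)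
      (λ x′<x → let y′ , y′<y , e = l x′<x in y′ , y′<y , go (rs x′<x) e)

  SameRank-¬< : WellFounded (Lt c) → ∀ {x y y′} →
                SameRank c d x y → SameRank c d x y′ → ¬ Lt d y y′
  SameRank-¬< wf = go (wf _)
    where
    go : ∀ {x y y′} → Acc (Lt c) x → SameRank c d x y → SameRank c d x y′ → ¬ Lt d y y′
    go (acc rs) (sameRank l _) (sameRank _ r′) y<y′ with r′ y<y′
    ... | x′ , x′<x , e′ with l x′<x
    ...   | y″ , y″<y , e = go (rs x′<x) e e′ y″<y

  SameRank-unique : ExcludedMiddle → IsLinear d → WellFounded (Lt c) → ∀ {x y y′} →
                    SameRank c d x y → SameRank c d x y′ → y ≡ y′
  SameRank-unique lem d-lin wf {y = y} {y′} e e′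
    with connex lem (IsLinear.isTotalOrder d-lin) y y′
  ... | inj₁ y<y′ = contradiction y<y′ (SameRank-¬< wf e e′)
  ... | inj₂ (inj₁ y≡y′) = y≡y′
  ... | inj₂ (inj₂ y′<y) = contradiction y′<y (SameRank-¬< wf e′ e)

  -- If no element of c has the rank of y₀, then y₀ lies above every element of d
  -- whose rank occurs in c, since these elements form an initial segment.
  unmatched-above : ExcludedMiddle → IsLinear d → ∀ {x y y₀} →
    SameRank c d x y → ¬ (∃ λ x → SameRank c d x y₀) → Lt d y y₀
  unmatched-above lem d-lin {x} {y} {y₀} e@(sameRank _ r) none
    with connex lem (IsLinear.isTotalOrder d-lin) y y₀
  ... | inj₁ y<y₀ = y<y₀
  ... | inj₂ (inj₁ refl) = contradiction (x , e) none
  ... | inj₂ (inj₂ y₀<y) = let x′ , _ , e′ = r y₀<y in contradiction (x′ , e′) none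

module _ (lem : ExcludedMiddle) {c d : Code} (c-lin : IsLinear c) (d-lin : IsLinear d)
  (c-wf : WellFounded (Lt c)) (d-wf : WellFounded (Lt d)) where

  -- If neither alternative held, the least elements without a counterpart on the
  -- two sides would have the same rank.
  comparable : RanksWithin c d ⊎ RanksWithin d c
  comparable with lem (∃ λ x → ¬ ∃ λ y → SameRank c d x y)
                | lem (∃ λ y → ¬ ∃ λ x → SameRank c d x y)
  ... | no all | _ = inj₁ λ x → decidable-stable (lem _) λ none → all (x , none)
  ... | yes _ | no all = inj₂ λ y →
    let x , e = decidable-stable (lem _) λ none → all (y , none)
    in x , SameRank-sym c-wf e
  ... | yes unmatched-c | yes unmatched-d
    with minimal lem c-wf _ unmatched-c | minimal lem d-wf _ unmatched-d
  ... | x₀ , none-x , x-min | y₀ , none-y , y-min =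
    contradiction (y₀ , sameRank below-x below-y) none-x
    where
    below-x : ∀ {x} → Lt c x x₀ → ∃ λ y → Lt d y y₀ × SameRank c d x y
    below-x x<x₀ =
      let y , e = decidable-stable (lem _) (x-min x<x₀)
      in y , unmatched-above lem d-lin e none-y , e

    below-y : ∀ {y} → Lt d y y₀ → ∃ λ x → Lt c x x₀ × SameRank c d x y
    below-y y<y₀ =
      let x , e = decidable-stable (lem _) (y-min y<y₀)
      in x , unmatched-above lem c-lin (SameRank-sym c-wf e)
               (λ (y , e′) → none-x (y , SameRank-sym d-wf e′)) , e

  ranksWithin⇒≅ : RanksWithin c d → RanksWithin d c → c ≅ d
  ranksWithin⇒≅ f g = proj₁ ∘ f , record
    { isOrderMonomorphism = strictlyMonotone⇒embedding lem
        (IsLinear.isTotalOrder c-lin) (IsLinear.isTotalOrder d-lin) mono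
    ; surjective = λ y → let x , e = g y in
        x , λ { refl → SameRank-unique lem d-lin c-wf (proj₂ (f x)) (SameRank-sym d-wf e) }
    }
    where
    mono : ∀ {x x′} → Lt c x x′ → Lt d (proj₁ (f x)) (proj₁ (f x′))
    mono {x} {x′} x<x′ with f x′
    ... | y′ , sameRank l _ with l x<x′
    ...   | y , y<y′ , e =
      subst (λ z → Lt d z y′) (SameRank-unique lem d-lin c-wf e (proj₂ (f x))) y<y′

≅⇒SameRank : ∀ {c d} → WellFounded (Lt c) → ((h , _) : c ≅ d) → ∀ x → SameRank c d x (h x)
≅⇒SameRank {c} {d} wf (h , h-iso) x = go (wf x)
  where
  module H = IsOrderIsomorphism h-iso

  go : ∀ {x} → Acc (Lt c) x → SameRank c d x (h x)
  go {x} (acc rs) = sameRank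
    (λ {x′} (x′≤x , ne) → h x′ , (H.mono x′≤x , ne ∘ H.injective) , go (rs (x′≤x , ne)))
    back
    where
    back : ∀ {y} → Lt d y (h x) → ∃ λ x′ → Lt c x′ x × SameRank c d x′ y
    back {y} (y≤hx , ne) with H.surjective y
    ... | x′ , hx′ with refl ← hx′ refl =
      x′ , (H.cancel y≤hx , ne ∘ cong h) , go (rs (H.cancel y≤hx , ne ∘ cong h))

------------------------------------------------------------------------
-- Embedding the countable ordinals in an unbounded set

-- A choice of an element outside P, if there is one, that depends only on the
-- extension of the subset P.
record Avoidance (U : Setoid 0ℓ 0ℓ) : Set₁ where
  open Setoid U
  field
    avoid      : Pred Carrier 0ℓ → Carrier
    avoid-cong : ∀ {P Q : Pred Carrier 0ℓ} → P ⊆ Q → Q ⊆ P → avoid P ≈ avoid Q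
    avoid-∉    : ∀ {P : Pred Carrier 0ℓ} → ∃ (λ y → ¬ P y) → ¬ P (avoid P)

avoidance : Choice → (U : Setoid 0ℓ 0ℓ) → Setoid.Carrier U → Avoidance U
avoidance ac U default = record
  { avoid      = λ P → proj₁ (proj₂ (choose P))
  ; avoid-cong = λ {P} {Q} p q → proj₂ (Func.cong (proj₁ split) {P} {Q} (p , q))
  ; avoid-∉    = λ {P} (z , z∉P) y∈P →
      proj₂ (proj₂ (choose P)) (z , z∉P ∘ proj₁ (proj₂ split P)) (proj₂ (proj₂ split P) y∈P)
  }
  where
  open Setoid U

  Subsets : Setoid (lsuc 0ℓ) 0ℓ
  Subsets = record
    { Carrier = Pred Carrier 0ℓ
    ; _≈_ = λ P Q → (∀ {y} → P y → Q y) × (∀ {y} → Q y → P y)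
    ; isEquivalence = record
      { refl = id , id
      ; sym = λ (p , q) → q , p
      ; trans = λ (p , q) (p′ , q′) → p′ ∘ p , q ∘ q′
      }
    }

  -- Subsets together with an admissible choice.
  Chosen : Setoid (lsuc 0ℓ) 0ℓ
  Chosen = record
    { Carrier = Σ (Pred Carrier 0ℓ) λ P → Σ Carrier λ y → ∃ (λ z → ¬ P z) → ¬ P y
    ; _≈_ = λ (P , y , _) (Q , z , _) → Setoid._≈_ Subsets P Q × y ≈ z
    ; isEquivalence = record
      { refl = (id , id) , Setoid.refl U
      ; sym = λ ((p , q) , e) → (q , p) , Setoid.sym U e
      ; trans = λ ((p , q) , e) ((p′ , q′) , e′) → (p′ ∘ p , q ∘ q′) , Setoid.trans U e e′
      }
    }

  admissible : ∀ P → Σ Carrier λ y → ∃ (λ z → ¬ P z) → ¬ P y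
  admissible P with excludedMiddle ac (∃ λ z → ¬ P z)
  ... | yes (z , z∉P) = z , λ _ → z∉P
  ... | no  none      = default , λ some → contradiction some none

  forget : Surjection Chosen Subsets
  forget = record
    { to = proj₁
    ; cong = proj₁
    ; surjective = λ P → (P , admissible P) , proj₁
    }

  split : Σ (Func Subsets Chosen) λ g →
          ∀ P → Setoid._≈_ Subsets (Surjection.to forget (Func.to g P)) P
  split = ac forget

  choose : Pred Carrier 0ℓ → Setoid.Carrier Chosen
  choose = Func.to (proj₁ split)

module _ {U : Setoid 0ℓ 0ℓ} (A : Avoidance U) where
  open Setoid U renaming (refl to ≈-refl; sym to ≈-sym; trans to ≈-trans)
  open Avoidance A

  -- Transfinite recursion: x is sent to an element of U that avoids the values
  -- at the predecessors of x, unless these exhaust U.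
  rankValue : ∀ {c} (x : Dom c) → Acc (Lt c) x → Carrier
  rankValue {c} x (acc rs) =
    avoid λ y → ∃ λ z → Σ (Lt c z x) λ z<x → y ≈ rankValue z (rs z<x)

  rankValue-cong : ∀ {c d} {x : Dom c} {y : Dom d} (a : Acc (Lt c) x) (b : Acc (Lt d) y) →
                   SameRank c d x y → rankValue x a ≈ rankValue y b
  rankValue-cong (acc rs) (acc rt) (sameRank l r) = avoid-cong
    (λ (z , z<x , e) → let z′ , z′<y , s = l z<x in
      z′ , z′<y , ≈-trans e (rankValue-cong (rs z<x) (rt z′<y) s))
    (λ (z′ , z′<y , e) → let z , z<x , s = r z′<y in
      z , z<x , ≈-trans e (≈-sym (rankValue-cong (rs z<x) (rt z′<y) s)))

  -- The values taken at the elements of an ordinal.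
  Values : Ordinal → Pred Carrier 0ℓ
  Values (c , _ , wf) y = ∃ λ z → y ≈ rankValue z (wf z)

  -- The value that an ordinal would take as an element of a longer one.
  value : Ordinal → Carrier
  value α = avoid (Values α)

  Values-⊆ : ∀ α β → RanksWithin (proj₁ α) (proj₁ β) → Values α ⊆ Values β
  Values-⊆ (_ , _ , wf) (_ , _ , wf′) f (z , e) =
    proj₁ (f z) , ≈-trans e (rankValue-cong (wf z) (wf′ _) (proj₂ (f z)))

  value-cong : ∀ α β → proj₁ α ≅ proj₁ β → value α ≈ value β
  value-cong α@(_ , _ , wf) β@(_ , _ , wf′) iso = avoid-cong
    (Values-⊆ α β (λ x → _ , ≅⇒SameRank wf iso x))
    (Values-⊆ β α (λ y → _ , ≅⇒SameRank wf′ (≅-sym iso) y))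

  module _ (lem : ExcludedMiddle) (fresh : ∀ α → ¬ Values α (value α)) where

    -- Otherwise the ranks of α would be the ranks in β below some y₀, so the value
    -- of α would be the value at y₀, which the value of β avoids.
    equalValues⇒ranksWithin : ∀ α β → RanksWithin (proj₁ α) (proj₁ β) →
                              value α ≈ value β → RanksWithin (proj₁ β) (proj₁ α)
    equalValues⇒ranksWithin α@(c , c-lin , c-wf) β@(d , d-lin , d-wf) f e =
      λ y → let x , s = decidable-stable (lem _) (λ none → unmatched (y , none))
            in x , SameRank-sym c-wf s
      where
      unmatched : ¬ ∃ λ y → ¬ ∃ λ x → SameRank c d x y
      unmatched some with minimal lem d-wf _ some
      ... | y₀ , none , y-min = fresh β (y₀ , ≈-trans (≈-sym e) (at-y₀ (d-wf y₀)))
        where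
        at-y₀ : (b : Acc (Lt d) y₀) → value α ≈ rankValue y₀ b
        at-y₀ (acc rt) = avoid-cong
          (λ (x , p) → let y , s = f x in let y<y₀ = unmatched-above lem d-lin s none in
            y , y<y₀ , ≈-trans p (rankValue-cong (c-wf x) (rt y<y₀) s))
          (λ (y , y<y₀ , p) → let x , s = decidable-stable (lem _) (y-min y<y₀) in
            x , ≈-trans p (≈-sym (rankValue-cong (c-wf x) (rt y<y₀) s)))

    value-injective : ∀ α β → value α ≈ value β → proj₁ α ≅ proj₁ β
    value-injective α@(_ , c-lin , c-wf) β@(_ , d-lin , d-wf) e
      with comparable lem c-lin d-lin c-wf d-wf
    ... | inj₁ f = ranksWithin⇒≅ lem c-lin d-lin c-wf d-wf f (equalValues⇒ranksWithin α β f e)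
    ... | inj₂ g =
      ranksWithin⇒≅ lem c-lin d-lin c-wf d-wf (equalValues⇒ranksWithin β α g (≈-sym e)) g

-- An unbounded set has at least ℵ₁ members.
unbounded⇒ω₁-injects : Choice → {𝓛 : Pred Lin ℓ} → Satisfiable 𝓛 → DownwardClosed 𝓛 →
  ∀ F → Unbounded LO-setoid (⊴LO 𝓛) F → Injection ω₁ (Subset.asSetoid F)
unbounded⇒ω₁-injects ac {𝓛} nonempty down F unbounded = record
  { to = value av
  ; cong = λ {α} {β} → value-cong av α β
  ; injective = λ {α} {β} → value-injective av lem fresh α β
  }
  where
  open Subset F

  lem : ExcludedMiddle
  lem = excludedMiddle ac

  -- A bounded subset of F does not exhaust F.
  outside : (P : Pred (∃ member) 0ℓ) → (u : LO) → (∀ y → P y → ⊴LO 𝓛 (proj₁ y) u) →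
            ∃ λ y → ¬ P y
  outside P u bound = decidable-stable (lem _) λ none → unbounded
    (u , λ y y∈ → bound (y , y∈) (decidable-stable (lem _) λ y∉P → none ((y , y∈) , y∉P)))

  -- F has an element, since any order bounds the empty set.
  av : Avoidance asSetoid
  av = avoidance ac asSetoid (proj₁ (outside (λ _ → ⊥) (toLO lem _≤_ ℕ.≤-isTotalOrder) λ _ ()))

  fresh : ∀ α → ¬ Values av α (value av α)
  fresh α@(c , _ , wf) = Avoidance.avoid-∉ av
    (let u , bound = countable-bounded lem nonempty down c (λ z → proj₁ (rankValue av z (wf z)))
     in outside (Values av α) u λ y (z , e) → bound z (proj₁ y) e)

theorem5p12 : (∀ {a b ℓ₁ ℓ₂} → AxiomOfChoice a b ℓ₁ ℓ₂) →
    ∀ {ℓ} (𝓛 : Pred Lin ℓ) →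
    𝓛 ⊆ Scat → Satisfiable 𝓛 → DownwardClosed 𝓛 → CCS 𝓛 →
    (Σ (Subset LO-setoid) λ F →
    HasSize LO-setoid F ω₁ × Unbounded LO-setoid (⊴LO 𝓛) F) ×
    IsUnboundingNumber LO-setoid (⊴LO 𝓛) ω₁
theorem5p12 ac 𝓛 𝓛⊆Scat nonempty down _ =
  unboundedFamily ac 𝓛⊆Scat , unboundedFamily ac 𝓛⊆Scat ,
  unbounded⇒ω₁-injects ac nonempty down
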